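{- Let $r\ge2$ and let $H$ be an $r$-graph with $h$ vertices. Then $$C_r(n,H)=O\left(n^{\frac{h-r}{h}}\cdot h^{2r+\frac{r}{h}}\right).$$
   Context: An $r$-graph is an $r$-uniform hypergraph; $K_n^{(r)}$ is the complete $r$-graph on $n$ vertices. For an $r$-graph $H$, an $(n,r,H)$-local coloring with $k$ colors is a family of $n$ edge-colorings $f_v:E(K_n^{(r)})\to[k]$, one for each vertex $v$ of $K_n^{(r)}$, such that for every copy $T$ of $H$ in $K_n^{(r)}$ there is a vertex $u\in V(T)$ for which $f_u$ is rainbow on $T$ (no two edges of $T$ get the same color under $f_u$). $C_r(n,H)$ is the minimum such $k$.
   Formalization: The formal theorem assumes h ≥ r: for h < r the r-graph H has no edges, so C_r(n,H) = 1 for n ≥ r while n^((h-r)/h) tends to 0 and the stated bound fails. -}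

module Defs where

open import Data.Nat using (ℕ; _≡ᵇ_)
open import Data.Bool using (Bool; true; false; _∧_; _∨_)
open import Data.Fin using (Fin; toℕ)
open import Data.Fin.Subset using (Subset; ∣_∣)
open import Data.List using (List; foldr; allFin)
open import Data.List.Relation.Unary.All using (All)
open import Data.List.Membership.Propositional using (_∈_)
open import Data.Vec using (lookup; tabulate)
open import Data.Product using (Σ)
open import Function.Definitions using (Injective)
open import Relation.Binary.PropositionalEquality using (_≡_; _≢_)

record Hypergraph (r h : ℕ) : Set where
  field
    edges   : List (Subset h)
    uniform : All (λ e → ∣ e ∣ ≡ r) edges
open Hypergraph public

image : {h n : ℕ} → (Fin h → Fin n) → Subset h → Subset n
image {h} φ s = tabulate λ j →
  foldr (λ i b → (lookup s i ∧ (toℕ (φ i) ≡ᵇ toℕ j)) ∨ b) false (allFin h)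

-- A colouring of the edges of K_n^(r) with k colours.  For convenience it is
-- given on all vertex subsets of Fin n; only its values on r-subsets matter
-- (the images of edges of H under injective maps are exactly r-subsets).
EdgeColoring : ℕ → ℕ → Set
EdgeColoring n k = Subset n → Fin k

Rainbow : {r h n k : ℕ} → Hypergraph r h → (Fin h → Fin n) → EdgeColoring n k → Set
Rainbow H φ f = ∀ e e′ → e ∈ edges H → e′ ∈ edges H → e ≢ e′ →
  f (image φ e) ≢ f (image φ e′)

LocalColoring : {r h : ℕ} → (n : ℕ) → Hypergraph r h → ℕ → Set
LocalColoring {h = h} n H k =
  Σ (Fin n → EdgeColoring n k) λ f →
    (φ : Fin h → Fin n) → Injective _≡_ _≡_ φ →
      Σ (Fin h) λ i → Rainbow H φ (f (φ i))

{-# OPTIONS --safe #-}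
-- The variables are the colours f_v(e).  A copy φ of H is bad iff for every vertex i of H two
-- distinct edges a_i, b_i of H get the same colour under f_{φ(i)}: for each choice of the pairs
-- (a_i, b_i), these are h equations between variables which are forbidden to hold together.  Given
-- the other variables, the h variables f_{φ(i)}(φ(a_i)) are determined by the equations, so with
-- k = 2q colours a choice is violated with "probability" k^(-h).  At most D = n^(h-r) h^(2rh+r)
-- choices (φ, a, b) involve a given variable.  Rosenfeld's counting argument replaces the local
-- lemma: if 2D ≤ q^h, then imposing the constraints through one more variable at most halves the
-- number of admissible colourings, by induction on the set of constrained variables.
module Submission where

open import Defs
open import Data.Bool as Bool using (Bool; true; false; _∧_; _∨_)
open import Data.Bool.Properties using (T-≡)
open import Data.Fin using (Fin; zero; suc; toℕ)
import Data.Fin.Properties as Fin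
open import Data.Fin.Subset as Subset using (Subset; ⊤; _-_; _⊂_; inside; outside; ⊥; ⁅_⁆; _∪_; ∣_∣)
open import Data.Fin.Subset.Induction using (Acc; acc; ⊂-wellFounded)
open import Data.Fin.Subset.Properties using (_∈?_; p─q⊆p; x∈p∧x≢y⇒x∈p-y; x∈p⇒p-x⊂p; ⊆-⊂-trans; ∈⊤; ⊆-antisym; x∈⁅x⁆; x∈⁅y⁆⇒x≡y; x∈p∪q⁺; x∈p∪q⁻; ∉⊥)
open import Data.List as List using (List; []; _∷_; _++_; map; length; allFin; cartesianProductWith; foldr; cartesianProduct; concatMap; filter)
open import Data.List.Membership.Propositional using (_∈_; find; lose)
open import Data.List.Membership.Propositional.Properties using (∈-allFin; ∈-map⁺; ∈-map⁻; ∈-cartesianProductWith⁺; ∈-filter⁺; ∈-filter⁻; ∈-concatMap⁺; ∈-cartesianProduct⁺; ∈-cartesianProduct⁻; ∈-cartesianProductWith⁻)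
open import Data.List.Membership.Propositional.Properties.WithK using (unique∧set⇒bag)
open import Data.List.Properties using (length-map; map-++; map-∘; length-tabulate; length-++; length-filter; map-cong-local) renaming (≡-dec to List-≡-dec)
open import Data.List.Relation.Binary.BagAndSetEquality using (∼bag⇒↭)
open import Data.List.Relation.Binary.Permutation.Propositional using (_↭_; ↭-sym)
open import Data.List.Relation.Binary.Permutation.Propositional.Properties using (↭-map-inv; ↭-length; ∈-resp-↭)
open import Data.List.Relation.Unary.All as All using (All; []; _∷_; all?)
open import Data.List.Relation.Unary.All.Properties as All using (¬Any⇒All¬)
open import Data.List.Relation.Unary.AllPairs using ([]; _∷_)
open import Data.List.Relation.Unary.Any as Any using (Any; here; there; any?)
open import Data.List.Relation.Unary.Any.Properties using (lookup-index)
import Data.List.Relation.Unary.Unique.DecPropositional as DecUnique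
open import Data.List.Relation.Unary.Unique.Propositional using (Unique)
open import Data.List.Relation.Unary.Unique.Propositional.Properties using (allFin⁺; map⁺; map⁻)
open import Data.Nat using (ℕ; zero; suc; _≤_; _<_; _*_; _+_; _∸_; _^_; z≤n; s≤s; NonZero; >-nonZero; _≤?_; _≡ᵇ_)
open import Data.Nat.ListAction using (sum)
open import Data.Nat.ListAction.Properties using (sum-++)
open import Data.Nat.Properties hiding (_≟_)
open import Data.Nat.Tactic.RingSolver using (solve-∀)
open import Data.Product using (Σ; ∃; _×_; _,_; proj₁; proj₂)
open import Data.Product.Properties using (,-injectiveˡ; ,-injectiveʳ)
open import Data.Sum using (_⊎_; inj₁; inj₂; [_,_]′)
open import Data.Unit using () renaming (⊤ to Unit)
open import Data.Vec as Vec using (Vec; []; _∷_; lookup; _[_]≔_; tabulate; toList; fromList)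
open import Data.Vec.Properties as Vec using (lookup∘update; lookup∘update′; lookup∘tabulate; []=⇒lookup; lookup⇒[]=; toList∘fromList; length-toList)
open import Function using (_∘_; id; mk⇔; Equivalence)
open import Function.Definitions using (Injective)
open import Relation.Binary.PropositionalEquality using (_≡_; _≢_; refl; sym; trans; cong; cong₂; subst; module ≡-Reasoning)
open import Relation.Nullary using (¬_; Dec; yes; no; contradiction; ¬?; _×-dec_; _⊎-dec_; _→-dec_)
open import Relation.Unary using (Pred; Decidable)

^-distribʳ-* : ∀ n a b → (a * b) ^ n ≡ a ^ n * b ^ n
^-distribʳ-* zero    a b = refl
^-distribʳ-* (suc n) a b rewrite ^-distribʳ-* n a b = interchange a b (a ^ n) (b ^ n)
  where
  interchange : ∀ a b c d → a * b * (c * d) ≡ a * c * (b * d)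
  interchange = solve-∀

-- Finite sums and counting

∑ : {A : Set} → List A → (A → ℕ) → ℕ
∑ xs f = sum (map f xs)

𝟙 : {P : Set} → Dec P → ℕ
𝟙 (yes _) = 1
𝟙 (no _)  = 0

module _ {A : Set} where

  ∑-mono : (xs : List A) {f g : A → ℕ} → (∀ {x} → x ∈ xs → f x ≤ g x) → ∑ xs f ≤ ∑ xs g
  ∑-mono []       f≤g = z≤n
  ∑-mono (x ∷ xs) f≤g = +-mono-≤ (f≤g (here refl)) (∑-mono xs (f≤g ∘ there))

  ∑-cong : (xs : List A) {f g : A → ℕ} → (∀ x → f x ≡ g x) → ∑ xs f ≡ ∑ xs g
  ∑-cong []       f≗g = refl
  ∑-cong (x ∷ xs) f≗g = cong₂ _+_ (f≗g x) (∑-cong xs f≗g)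

  ∑-+ : (xs : List A) (f g : A → ℕ) → ∑ xs (λ x → f x + g x) ≡ ∑ xs f + ∑ xs g
  ∑-+ []       f g = refl
  ∑-+ (x ∷ xs) f g rewrite ∑-+ xs f g = interchange (f x) (g x) (∑ xs f) (∑ xs g)
    where
    interchange : ∀ a b c d → a + b + (c + d) ≡ a + c + (b + d)
    interchange = solve-∀

  ∑-*ˡ : (xs : List A) (m : ℕ) (f : A → ℕ) → ∑ xs (λ x → m * f x) ≡ m * ∑ xs f
  ∑-*ˡ []       m f = sym (*-zeroʳ m)
  ∑-*ˡ (x ∷ xs) m f rewrite ∑-*ˡ xs m f = sym (*-distribˡ-+ m (f x) (∑ xs f))

  ∑-const : (xs : List A) (m : ℕ) → ∑ xs (λ _ → m) ≡ length xs * m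
  ∑-const []       m = refl
  ∑-const (x ∷ xs) m = cong (m +_) (∑-const xs m)

  ∑-++ : (xs ys : List A) (f : A → ℕ) → ∑ (xs ++ ys) f ≡ ∑ xs f + ∑ ys f
  ∑-++ xs ys f rewrite map-++ f xs ys = sum-++ (map f xs) (map f ys)

  ∈⇒≤∑ : {xs : List A} (f : A → ℕ) {x : A} → x ∈ xs → f x ≤ ∑ xs f
  ∈⇒≤∑ f (here refl)  = m≤m+n _ _
  ∈⇒≤∑ f (there x∈xs) = ≤-trans (∈⇒≤∑ f x∈xs) (m≤n+m _ _)

  ∑>0⇒∃ : (xs : List A) {f : A → ℕ} → 0 < ∑ xs f → ∃ λ x → 0 < f x
  ∑>0⇒∃ (x ∷ xs) {f} 0<∑ with f x in eq
  ... | zero  = ∑>0⇒∃ xs 0<∑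
  ... | suc _ = x , subst (0 <_) (sym eq) (s≤s z≤n)

  -- A duplicate-free list contains `d` at most once, so at most one term is nonzero, and a nonzero
  -- term forces `P`.
  ∑-𝟙-unique : {xs : List A} {P : Set} {R : Pred A _} (P? : Dec P) (R? : Decidable R) (d : A) →
               Unique xs → (∀ c → R c → P × c ≡ d) → ∑ xs (𝟙 ∘ R?) ≤ 𝟙 P?
  ∑-𝟙-unique P? R? d [] R⇒ = z≤n
  ∑-𝟙-unique {c ∷ xs} P? R? d (c∉xs ∷ !xs) R⇒ with R? c
  ... | no  _  = ∑-𝟙-unique P? R? d !xs R⇒
  ... | yes Rc with P? | R⇒ c Rc
  ...   | no ¬p | p , _    = contradiction p ¬p
  ...   | yes _ | _ , refl = s≤s (rest≤0 xs c∉xs)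
    where
    rest≤0 : ∀ ys → All (c ≢_) ys → ∑ ys (𝟙 ∘ R?) ≤ 0
    rest≤0 []       []           = z≤n
    rest≤0 (y ∷ ys) (c≢y ∷ c∉ys) with R? y
    ... | yes Ry = contradiction (sym (proj₂ (R⇒ y Ry))) c≢y
    ... | no  _  = rest≤0 ys c∉ys

∑-swap : {A B : Set} (xs : List A) (ys : List B) (f : A → B → ℕ) →
           ∑ xs (λ x → ∑ ys (f x)) ≡ ∑ ys (λ y → ∑ xs (λ x → f x y))
∑-swap []       ys f = sym (trans (∑-const ys 0) (*-zeroʳ (length ys)))
∑-swap (x ∷ xs) ys f rewrite ∑-swap xs ys f = sym (∑-+ ys (f x) _)

𝟙-yes : {P : Set} (P? : Dec P) → P → 𝟙 P? ≡ 1
𝟙-yes (yes _) p = refl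
𝟙-yes (no ¬p) p = contradiction p ¬p

𝟙-≤ : {P : Set} {m : ℕ} (P? : Dec P) → (P → 1 ≤ m) → 𝟙 P? ≤ m
𝟙-≤ (yes p) 1≤m = 1≤m p
𝟙-≤ (no _)  1≤m = z≤n

𝟙-mono : {P Q : Set} (P? : Dec P) (Q? : Dec Q) → (P → Q) → 𝟙 P? ≤ 𝟙 Q?
𝟙-mono P? Q? P⇒Q = 𝟙-≤ P? λ p → ≤-reflexive (sym (𝟙-yes Q? (P⇒Q p)))

𝟙>0⇒ : {P : Set} (P? : Dec P) → 0 < 𝟙 P? → P
𝟙>0⇒ (yes p) _ = p

∑-cartesianProductWith : {A B C : Set} (f : A → B → C) (xs : List A) (ys : List B) (F : C → ℕ) →
  ∑ (cartesianProductWith f xs ys) F ≡ ∑ xs (λ x → ∑ ys (λ y → F (f x y)))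
∑-cartesianProductWith f []       ys F = refl
∑-cartesianProductWith f (x ∷ xs) ys F = begin
  ∑ (map (f x) ys ++ cartesianProductWith f xs ys) F
    ≡⟨ ∑-++ (map (f x) ys) _ F ⟩
  ∑ (map (f x) ys) F + ∑ (cartesianProductWith f xs ys) F
    ≡⟨ cong₂ _+_ (cong sum (sym (map-∘ ys))) (∑-cartesianProductWith f xs ys F) ⟩
  ∑ ys (F ∘ f x) + ∑ xs (λ x → ∑ ys (λ y → F (f x y))) ∎
  where open ≡-Reasoning

-- Enumerating vectors and resampling a coordinate

module _ {A : Set} where

  vecs : List A → (m : ℕ) → List (Vec A m)
  vecs xs zero    = [] ∷ []
  vecs xs (suc m) = cartesianProductWith _∷_ xs (vecs xs m)

  ∈-vecs : {xs : List A} {m : ℕ} (v : Vec A m) → (∀ i → lookup v i ∈ xs) → v ∈ vecs xs m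
  ∈-vecs []      _    = here refl
  ∈-vecs (a ∷ v) v∈xs = ∈-cartesianProductWith⁺ _∷_ (v∈xs zero) (∈-vecs v (v∈xs ∘ suc))

  length-vecs : (xs : List A) (m : ℕ) → length (vecs xs m) ≡ length xs ^ m
  length-vecs xs zero    = refl
  length-vecs xs (suc m) = begin
    length (vecs xs (suc m))             ≡⟨ length-as-∑ (vecs xs (suc m)) ⟩
    ∑ (vecs xs (suc m)) (λ _ → 1)        ≡⟨ ∑-cartesianProductWith _∷_ xs (vecs xs m) _ ⟩
    ∑ xs (λ _ → ∑ (vecs xs m) (λ _ → 1)) ≡⟨ ∑-const xs _ ⟩
    length xs * ∑ (vecs xs m) (λ _ → 1)  ≡⟨ cong (length xs *_) (sym (length-as-∑ (vecs xs m))) ⟩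
    length xs * length (vecs xs m)       ≡⟨ cong (length xs *_) (length-vecs xs m) ⟩
    length xs * length xs ^ m            ∎
    where
    open ≡-Reasoning
    length-as-∑ : {B : Set} (ys : List B) → length ys ≡ ∑ ys (λ _ → 1)
    length-as-∑ ys = sym (trans (∑-const ys 1) (*-identityʳ _))

  -- Overwriting coordinate `i` forgets its old entry, so each vector arises once for every possible
  -- old entry.
  ∑-resample : (xs : List A) {m : ℕ} (i : Fin m) (F : Vec A m → ℕ) →
    ∑ xs (λ c → ∑ (vecs xs m) (λ v → F (v [ i ]≔ c))) ≡ length xs * ∑ (vecs xs m) F
  ∑-resample xs {suc m} zero F = begin
    ∑ xs (λ c → ∑ (vecs xs (suc m)) (λ v → F (v [ zero ]≔ c)))
      ≡⟨ ∑-cong xs (λ c → ∑-cartesianProductWith _∷_ xs (vecs xs m) (λ v → F (v [ zero ]≔ c))) ⟩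
    ∑ xs (λ c → ∑ xs (λ _ → ∑ (vecs xs m) (λ v → F (c ∷ v))))
      ≡⟨ ∑-cong xs (λ c → ∑-const xs _) ⟩
    ∑ xs (λ c → length xs * ∑ (vecs xs m) (λ v → F (c ∷ v)))
      ≡⟨ ∑-*ˡ xs (length xs) _ ⟩
    length xs * ∑ xs (λ c → ∑ (vecs xs m) (λ v → F (c ∷ v)))
      ≡⟨ cong (length xs *_) (sym (∑-cartesianProductWith _∷_ xs (vecs xs m) F)) ⟩
    length xs * ∑ (vecs xs (suc m)) F ∎
    where open ≡-Reasoning
  ∑-resample xs {suc m} (suc i) F = begin
    ∑ xs (λ c → ∑ (vecs xs (suc m)) (λ v → F (v [ suc i ]≔ c)))
      ≡⟨ ∑-cong xs (λ c → ∑-cartesianProductWith _∷_ xs (vecs xs m) (λ v → F (v [ suc i ]≔ c))) ⟩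
    ∑ xs (λ c → ∑ xs (λ a → ∑ (vecs xs m) (λ v → F (a ∷ v [ i ]≔ c))))
      ≡⟨ ∑-swap xs xs _ ⟩
    ∑ xs (λ a → ∑ xs (λ c → ∑ (vecs xs m) (λ v → F (a ∷ v [ i ]≔ c))))
      ≡⟨ ∑-cong xs (λ a → ∑-resample xs i (λ v → F (a ∷ v))) ⟩
    ∑ xs (λ a → length xs * ∑ (vecs xs m) (λ v → F (a ∷ v)))
      ≡⟨ ∑-*ˡ xs (length xs) _ ⟩
    length xs * ∑ xs (λ a → ∑ (vecs xs m) (λ v → F (a ∷ v)))
      ≡⟨ cong (length xs *_) (sym (∑-cartesianProductWith _∷_ xs (vecs xs m) F)) ⟩
    length xs * ∑ (vecs xs (suc m)) F ∎
    where open ≡-Reasoning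

allVecs : (k m : ℕ) → List (Vec (Fin k) m)
allVecs k m = vecs (allFin k) m

length-allFin : ∀ k → length (allFin k) ≡ k
length-allFin k = length-tabulate id

length-allVecs : ∀ k m → length (allVecs k m) ≡ k ^ m
length-allVecs k m = trans (length-vecs (allFin k) m) (cong (_^ m) (length-allFin k))

# : {k m : ℕ} {P : Pred (Vec (Fin k) m) _} → Decidable P → ℕ
# {k} {m} P? = ∑ (allVecs k m) (𝟙 ∘ P?)

-- Double counting of the pairs `(v , c)` for which `Q` holds after `c` is written at `i`.
-- Resampling gives `k` times the number of `Q`-vectors, while each `v` admits at most the one value
-- `y v`, and only if `P v`. It is the counting form of conditioning on the other coordinates.
#-determined : {k m : ℕ} {P Q : Pred (Vec (Fin k) m) _} (P? : Decidable P) (Q? : Decidable Q)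
  (i : Fin m) (y : Vec (Fin k) m → Fin k) →
  (∀ v c → Q (v [ i ]≔ c) → P v × c ≡ y v) → k * # Q? ≤ # P?
#-determined {k} {m} P? Q? i y Q⇒ = begin
  k * # Q?
    ≡⟨ cong (_* # Q?) (sym (length-allFin k)) ⟩
  length (allFin k) * # Q?
    ≡⟨ sym (∑-resample (allFin k) i (𝟙 ∘ Q?)) ⟩
  ∑ (allFin k) (λ c → ∑ (allVecs k m) (λ v → 𝟙 (Q? (v [ i ]≔ c))))
    ≡⟨ ∑-swap (allFin k) (allVecs k m) _ ⟩
  ∑ (allVecs k m) (λ v → ∑ (allFin k) (λ c → 𝟙 (Q? (v [ i ]≔ c))))
    ≤⟨ ∑-mono (allVecs k m) (λ {v} _ → ∑-𝟙-unique (P? v) (λ c → Q? (v [ i ]≔ c)) (y v) (allFin⁺ k) (Q⇒ v)) ⟩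
  # P? ∎
  where open ≤-Reasoning

#-mono : {k m : ℕ} {P Q : Pred (Vec (Fin k) m) _} (P? : Decidable P) (Q? : Decidable Q) →
  (∀ v → P v → Q v) → # P? ≤ # Q?
#-mono {k} {m} P? Q? P⇒Q = ∑-mono (allVecs k m) (λ {v} _ → 𝟙-mono (P? v) (Q? v) (P⇒Q v))

-- Counting colourings that avoid constraints

-- A constraint forbids that all of its equations g x ≡ g y hold simultaneously.
Constraint : ℕ → Set
Constraint N = List (Fin N × Fin N)

module _ {N : ℕ} where

  Violates : {k : ℕ} → Constraint N → Vec (Fin k) N → Set
  Violates C g = All (λ xy → lookup g (proj₁ xy) ≡ lookup g (proj₂ xy)) C

  violates? : {k : ℕ} (C : Constraint N) → Decidable (Violates {k} C)
  violates? C g = all? (λ xy → lookup g (proj₁ xy) Fin.≟ lookup g (proj₂ xy)) C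

  Occurs : Fin N → Fin N × Fin N → Set
  Occurs x xy = x ≡ proj₁ xy ⊎ x ≡ proj₂ xy

  occurs? : (x : Fin N) → Decidable (Occurs x)
  occurs? x xy = x Fin.≟ proj₁ xy ⊎-dec x Fin.≟ proj₂ xy

  -- The equations can be solved one after the other for their left-hand sides.
  Triangular : Constraint N → Set
  Triangular []            = Unit
  Triangular ((x , y) ∷ C) = x ≢ y × All (¬_ ∘ Occurs x) C × Triangular C

  Within : Subset N → Constraint N → Set
  Within S = All (λ xy → (proj₁ xy Subset.∈ S) × (proj₂ xy Subset.∈ S))

  within? : (S : Subset N) → Decidable (Within S)
  within? S = all? (λ xy → (proj₁ xy ∈? S) ×-dec (proj₂ xy ∈? S))

  violates-update : {k : ℕ} {x : Fin N} {c : Fin k} {C : Constraint N} (g : Vec (Fin k) N) →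
    All (¬_ ∘ Occurs x) C → Violates C (g [ x ]≔ c) → Violates C g
  violates-update g []          []       = []
  violates-update g (x∉ ∷ x∉C) (eq ∷ eqs) =
    trans (sym (lookup∘update′ (x∉ ∘ inj₁ ∘ sym) g _)) (trans eq (lookup∘update′ (x∉ ∘ inj₂ ∘ sym) g _))
    ∷ violates-update g x∉C eqs

  violates-update⁻ : {k : ℕ} {x : Fin N} {c : Fin k} {C : Constraint N} (g : Vec (Fin k) N) →
    All (¬_ ∘ Occurs x) C → Violates C g → Violates C (g [ x ]≔ c)
  violates-update⁻ g []          []       = []
  violates-update⁻ g (x∉ ∷ x∉C) (eq ∷ eqs) =
    trans (lookup∘update′ (x∉ ∘ inj₁ ∘ sym) g _) (trans eq (sym (lookup∘update′ (x∉ ∘ inj₂ ∘ sym) g _)))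
    ∷ violates-update⁻ g x∉C eqs

  -- The left-hand side of the first equation does not occur in the later ones, and `P` does not
  -- depend on it, so the other variables force its value. Each equation thus costs a factor `k`.
  #-violating : {k : ℕ} {P : Pred (Vec (Fin k) N) _} (P? : Decidable P) (C : Constraint N) →
    Triangular C → (∀ {xy} → xy ∈ C → ∀ g c → P (g [ proj₁ xy ]≔ c) → P g) →
    k ^ length C * # (λ g → P? g ×-dec violates? C g) ≤ # P?
  #-violating P? [] _ _ =
    ≤-trans (≤-reflexive (*-identityˡ _)) (#-mono (λ g → P? g ×-dec violates? [] g) P? (λ _ → proj₁))
  #-violating {k} {P} P? ((x , y) ∷ C) (x≢y , x∉C , triangular) invariant = begin
    k * k ^ length C * # Q?   ≡⟨ cong (_* # Q?) (*-comm k (k ^ length C)) ⟩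
    k ^ length C * k * # Q?   ≡⟨ *-assoc (k ^ length C) k (# Q?) ⟩
    k ^ length C * (k * # Q?) ≤⟨ *-monoʳ-≤ (k ^ length C) (#-determined P∧C? Q? x (λ g → lookup g y) solve) ⟩
    k ^ length C * # P∧C?     ≤⟨ #-violating P? C triangular (invariant ∘ there) ⟩
    # P?                      ∎
    where
    open ≤-Reasoning
    P∧C? = λ g → P? g ×-dec violates? C g
    Q? = λ g → P? g ×-dec violates? ((x , y) ∷ C) g
    solve : ∀ g c → P (g [ x ]≔ c) × Violates ((x , y) ∷ C) (g [ x ]≔ c) → (P g × Violates C g) × c ≡ lookup g y
    solve g c (Pg , eq ∷ eqs) = (invariant (here refl) g c Pg , violates-update g x∉C eqs) ,
      trans (sym (lookup∘update x g c)) (trans eq (lookup∘update′ (x≢y ∘ sym) g c))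

-- Deleting variables and Rosenfeld's induction

x∉p-x : {n : ℕ} (p : Subset n) (x : Fin n) → x Subset.∉ p - x
x∉p-x (inside  ∷ p) zero ()
x∉p-x (outside ∷ p) zero ()
x∉p-x (inside  ∷ p) (suc x) (Vec.there x∈) = x∉p-x p x x∈
x∉p-x (outside ∷ p) (suc x) (Vec.there x∈) = x∉p-x p x x∈

removeAll : {n : ℕ} → Subset n → List (Fin n) → Subset n
removeAll S = foldr (λ x T → T - x) S

removeAll-⊆ : {n : ℕ} (S : Subset n) (xs : List (Fin n)) → removeAll S xs Subset.⊆ S
removeAll-⊆ S []       = id
removeAll-⊆ S (x ∷ xs) = removeAll-⊆ S xs ∘ p─q⊆p _ _

∉-removeAll : {n : ℕ} (S : Subset n) {xs : List (Fin n)} {x : Fin n} → x ∈ xs → x Subset.∉ removeAll S xs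
∉-removeAll S {x ∷ xs} (here refl) = x∉p-x (removeAll S xs) x
∉-removeAll S          (there x∈)  = ∉-removeAll S x∈ ∘ p─q⊆p _ _

-- The list at x need not consist of constraints from 𝒞: it only has to contain, for each member
-- of 𝒞 through x, a constraint that is violated whenever that member is.
module Avoidance {N q h : ℕ} (𝒞 : List (Constraint N)) (at : Fin N → List (Constraint N))
  (0<q : 0 < q)
  (nonempty : ∀ {C} → C ∈ 𝒞 → C ≢ [])
  (shape : ∀ {x C} → C ∈ at x → Triangular C × length C ≡ h)
  (few : ∀ x → 2 * length (at x) ≤ q ^ h)
  (dominated : ∀ {x xy C} → C ∈ 𝒞 → xy ∈ C → Occurs x xy →
               ∃ λ C′ → C′ ∈ at x × (∀ (g : Vec (Fin (2 * q)) N) → Violates C g → Violates C′ g))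
  where

  Colouring : Set
  Colouring = Vec (Fin (2 * q)) N

  -- Only constraints lying wholly within `S` are imposed. Variables outside `S` are coloured as
  -- well, so all counts range over the same colourings and those variables are free.
  Admissible : Subset N → Colouring → Set
  Admissible S g = All (λ C → ¬ (Within S C × Violates C g)) 𝒞

  admissible? : (S : Subset N) → Decidable (Admissible S)
  admissible? S g = all? (λ C → ¬? (within? S C ×-dec violates? C g)) 𝒞

  admissible-antitone : {S T : Subset N} → T Subset.⊆ S → ∀ g → Admissible S g → Admissible T g
  admissible-antitone T⊆S g = All.map (λ ok (inT , viol) → ok (All.map (λ (x∈ , y∈) → T⊆S x∈ , T⊆S y∈) inT , viol))

  -- No imposed constraint contains `x`, so recolouring `x` is harmless. This supplies the
  -- invariance needed when the equations of a constraint are solved for their left-hand sides.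
  admissible-update : {S : Subset N} {x : Fin N} → x Subset.∉ S → ∀ g c → Admissible S (g [ x ]≔ c) → Admissible S g
  admissible-update {S} {x} x∉S g c = All.map λ ok (inS , viol) →
    ok (inS , violates-update⁻ g (All.map x∉ inS) viol)
    where
    x∉ : ∀ {xy} → (proj₁ xy Subset.∈ S) × (proj₂ xy Subset.∈ S) → ¬ Occurs x xy
    x∉ (y∈ , _) (inj₁ refl) = x∉S y∈
    x∉ (_ , y∈) (inj₂ refl) = x∉S y∈

  #Adm : Subset N → ℕ
  #Adm S = # (admissible? S)

  Halving : Subset N → Set
  Halving S = ∀ x → #Adm (S - x) ≤ 2 * #Adm S

  -- One factor 2 is paid per deleted variable. The intermediate sets shrink, hence the hypothesis
  -- for every subset of `S`.
  #Adm-removeAll : (S : Subset N) → (∀ {T} → T Subset.⊆ S → Halving T) →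
    ∀ xs → #Adm (removeAll S xs) ≤ 2 ^ length xs * #Adm S
  #Adm-removeAll S halving []       = ≤-reflexive (sym (*-identityˡ _))
  #Adm-removeAll S halving (x ∷ xs) = begin
    #Adm (removeAll S xs - x)         ≤⟨ halving (removeAll-⊆ S xs) x ⟩
    2 * #Adm (removeAll S xs)         ≤⟨ *-monoʳ-≤ 2 (#Adm-removeAll S halving xs) ⟩
    2 * (2 ^ length xs * #Adm S)      ≡⟨ sym (*-assoc 2 (2 ^ length xs) (#Adm S)) ⟩
    2 * 2 ^ length xs * #Adm S        ∎
    where open ≤-Reasoning

  lost? : (S : Subset N) (C : Constraint N) → Decidable (λ g → Admissible S g × Violates C g)
  lost? S C g = admissible? S g ×-dec violates? C g

  -- Once the `h` left-hand sides of `C` are deleted from `S` they are free, and all equations hold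
  -- for at most one in `(2 * q) ^ h` of the admissible colourings. The deletion multiplied the
  -- number of these by at most `2 ^ h`, which leaves one in `q ^ h`.
  #lost : (S : Subset N) → (∀ {T} → T Subset.⊆ S → Halving T) → ∀ {x C} → C ∈ at x →
    q ^ h * # (lost? S C) ≤ #Adm S
  #lost S halving {x} {C} C∈ with shape C∈
  ... | triangular , ∣C∣≡h = *-cancelˡ-≤ (2 ^ h) {{m^n≢0 2 h}} (begin
    2 ^ h * (q ^ h * # (lost? S C))   ≡⟨ sym (*-assoc (2 ^ h) (q ^ h) _) ⟩
    2 ^ h * q ^ h * # (lost? S C)     ≡⟨ cong (_* # (lost? S C)) (sym (^-distribʳ-* h 2 q)) ⟩
    (2 * q) ^ h * # (lost? S C)       ≤⟨ *-monoʳ-≤ ((2 * q) ^ h) (#-mono (lost? S C) (lost? S∖X C)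
                                           (λ g (adm , viol) → admissible-antitone (removeAll-⊆ S X) g adm , viol)) ⟩
    (2 * q) ^ h * # (lost? S∖X C)     ≡⟨ cong (λ l → (2 * q) ^ l * # (lost? S∖X C)) (sym ∣C∣≡h) ⟩
    (2 * q) ^ length C * # (lost? S∖X C) ≤⟨ #-violating (admissible? S∖X) C triangular
                                           (λ xy∈ → admissible-update (∉-removeAll S (∈-map⁺ proj₁ xy∈))) ⟩
    #Adm S∖X                          ≤⟨ #Adm-removeAll S halving X ⟩
    2 ^ length X * #Adm S             ≡⟨ cong (λ l → 2 ^ l * #Adm S) (trans (length-map proj₁ C) ∣C∣≡h) ⟩
    2 ^ h * #Adm S                    ∎)
    where
    open ≤-Reasoning
    X = map proj₁ C
    S∖X = removeAll S X

  -- If admissibility fails when `x` returns, some constraint within `S` is violated. It contains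
  -- `x`, as otherwise it would lie within `S - x`; so a dominating constraint in `at x` is violated
  -- too and contributes 1.
  lost-cover : (S : Subset N) (x : Fin N) (g : Colouring) →
    Admissible (S - x) g → 1 ≤ 𝟙 (admissible? S g) + ∑ (at x) (λ C → 𝟙 (lost? (S - x) C g))
  lost-cover S x g adm with any? (λ C → within? S C ×-dec violates? C g) 𝒞
  ... | no ¬bad = ≤-trans (≤-reflexive (sym (𝟙-yes (admissible? S g) (¬Any⇒All¬ 𝒞 ¬bad)))) (m≤m+n _ _)
  ... | yes bad with find bad
  ...   | C , C∈ , inS , viol with any? (occurs? x) C
  ...     | no x∉C = contradiction (All.zipWith inS-x (inS , ¬Any⇒All¬ C x∉C) , viol) (All.lookup adm C∈)
    where
    inS-x : ∀ {xy} → ((proj₁ xy Subset.∈ S) × (proj₂ xy Subset.∈ S)) × ¬ Occurs x xy →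
            (proj₁ xy Subset.∈ S - x) × (proj₂ xy Subset.∈ S - x)
    inS-x ((y∈ , z∈) , x∉) =
      x∈p∧x≢y⇒x∈p-y y∈ (x∉ ∘ inj₁ ∘ sym) , x∈p∧x≢y⇒x∈p-y z∈ (x∉ ∘ inj₂ ∘ sym)
  ...     | yes x∈C with find x∈C
  ...       | xy , xy∈ , occ with dominated C∈ xy∈ occ
  ...         | C′ , C′∈ , viol⇒ = begin
    1
      ≡⟨ sym (𝟙-yes (lost? (S - x) C′ g) (adm , viol⇒ g viol)) ⟩
    𝟙 (lost? (S - x) C′ g)
      ≤⟨ ∈⇒≤∑ (λ C → 𝟙 (lost? (S - x) C g)) C′∈ ⟩
    ∑ (at x) (λ C → 𝟙 (lost? (S - x) C g))
      ≤⟨ m≤n+m _ _ ⟩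
    𝟙 (admissible? S g) + ∑ (at x) (λ C → 𝟙 (lost? (S - x) C g)) ∎
    where open ≤-Reasoning

  -- Let `A′` and `A` be the counts before and after `x` is restored. By `lost-cover`, `A′ ≤ A + B`.
  -- Each entry of `at x` loses at most a fraction `1 / q ^ h` of `A′`, and `few` allows at most
  -- `q ^ h / 2` entries, so `2 * B ≤ A′`. The induction hypothesis is applied to subsets of
  -- `S - x`.
  halving : (S : Subset N) → Acc _⊂_ S → Halving S
  halving S (acc rec) x with x ∈? S
  -- For `x` outside `S` the deletion changes nothing, and the recursion would not descend.
  ... | no x∉S = ≤-trans (#-mono (admissible? (S - x)) (admissible? S) (admissible-antitone S⊆S-x)) (m≤m+n _ _)
    where
    S⊆S-x : S Subset.⊆ S - x
    S⊆S-x y∈S = x∈p∧x≢y⇒x∈p-y y∈S λ { refl → x∉S y∈S }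
  -- To avoid subtraction, `2 * A′ ≤ 2 * A + A′` is proved and one `A′` cancelled.
  ... | yes x∈S = +-cancelʳ-≤ A′ A′ (2 * A) (begin
    A′ + A′       ≡⟨ cong (A′ +_) (sym (+-identityʳ A′)) ⟩
    2 * A′        ≤⟨ *-monoʳ-≤ 2 A′≤A+B ⟩
    2 * (A + B)   ≡⟨ *-distribˡ-+ 2 A B ⟩
    2 * A + 2 * B ≤⟨ +-monoʳ-≤ (2 * A) 2B≤A′ ⟩
    2 * A + A′    ∎)
    where
    open ≤-Reasoning
    S′ = S - x
    A = #Adm S
    A′ = #Adm S′
    B = ∑ (at x) (λ C → # (lost? S′ C))
    halving′ : ∀ {T} → T Subset.⊆ S′ → Halving T
    halving′ T⊆S′ = halving _ (rec (⊆-⊂-trans T⊆S′ (x∈p⇒p-x⊂p x∈S)))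
    A′≤A+B : A′ ≤ A + B
    A′≤A+B = begin
      A′
        ≤⟨ ∑-mono (allVecs (2 * q) N) (λ {g} _ → 𝟙-≤ (admissible? S′ g) (lost-cover S x g)) ⟩
      ∑ (allVecs (2 * q) N) (λ g → 𝟙 (admissible? S g) + ∑ (at x) (λ C → 𝟙 (lost? S′ C g)))
        ≡⟨ ∑-+ (allVecs (2 * q) N) _ _ ⟩
      A + ∑ (allVecs (2 * q) N) (λ g → ∑ (at x) (λ C → 𝟙 (lost? S′ C g)))
        ≡⟨ cong (A +_) (∑-swap (allVecs (2 * q) N) (at x) _) ⟩
      A + B ∎
    2B≤A′ : 2 * B ≤ A′
    2B≤A′ = *-cancelˡ-≤ (q ^ h) {{m^n≢0 q h {{>-nonZero 0<q}}}} (begin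
      q ^ h * (2 * B)
        ≡⟨ *-left-comm (q ^ h) 2 B ⟩
      2 * (q ^ h * B)
        ≡⟨ cong (2 *_) (sym (∑-*ˡ (at x) (q ^ h) _)) ⟩
      2 * ∑ (at x) (λ C → q ^ h * # (lost? S′ C))
        ≤⟨ *-monoʳ-≤ 2 (∑-mono (at x) (#lost S′ halving′)) ⟩
      2 * ∑ (at x) (λ _ → A′)
        ≡⟨ cong (2 *_) (∑-const (at x) A′) ⟩
      2 * (length (at x) * A′)
        ≡⟨ sym (*-assoc 2 (length (at x)) A′) ⟩
      2 * length (at x) * A′
        ≤⟨ *-monoˡ-≤ A′ (few x) ⟩
      q ^ h * A′ ∎)
      where
      *-left-comm : ∀ a b c → a * (b * c) ≡ b * (a * c)
      *-left-comm = solve-∀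

  -- With no variable restored, all `(2 * q) ^ N` colourings are admissible. Restoring the `N`
  -- variables divides the count by at most `2 ^ N`, so it is still positive at `⊤`.
  avoiding : ∃ λ (g : Colouring) → ∀ {C} → C ∈ 𝒞 → ¬ Violates C g
  avoiding with ∑>0⇒∃ (allVecs (2 * q) N) #Adm⊤>0
    where
    -- The empty set is reached from `⊤` by deletions, the form to which `#Adm-removeAll` applies.
    empty = removeAll ⊤ (allFin N)
    unsupported : ∀ g {C} → C ∈ 𝒞 → ¬ (Within empty C × Violates C g)
    -- The empty constraint lies within every set and is always violated; `nonempty` rules it out.
    unsupported g {[]}    C∈ _                  = nonempty C∈ refl
    unsupported g {_ ∷ _} _  ((x∈ , _) ∷ _ , _) = ∉-removeAll ⊤ (∈-allFin _) x∈
    all-admissible : ∀ g → Admissible empty g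
    all-admissible g = All.tabulate (unsupported g)
    #Adm⊤>0 : 0 < #Adm ⊤
    #Adm⊤>0 = *-cancelˡ-< (2 ^ length (allFin N)) 0 (#Adm ⊤) (begin-strict
      2 ^ length (allFin N) * 0           ≡⟨ *-zeroʳ (2 ^ length (allFin N)) ⟩
      0                                   <⟨ m^n>0 (2 * q) {{>-nonZero (≤-trans 0<q (m≤m+n q _))}} N ⟩
      (2 * q) ^ N                         ≡⟨ sym (length-allVecs (2 * q) N) ⟩
      length (allVecs (2 * q) N)          ≡⟨ sym (*-identityʳ _) ⟩
      length (allVecs (2 * q) N) * 1      ≡⟨ sym (∑-const (allVecs (2 * q) N) 1) ⟩
      ∑ (allVecs (2 * q) N) (λ _ → 1)     ≤⟨ ∑-mono (allVecs (2 * q) N) (λ {g} _ →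
                                               ≤-reflexive (sym (𝟙-yes (admissible? empty g) (all-admissible g)))) ⟩
      #Adm empty                          ≤⟨ #Adm-removeAll ⊤ (λ _ → halving _ (⊂-wellFounded _)) (allFin N) ⟩
      2 ^ length (allFin N) * #Adm ⊤      ∎)
      where open ≤-Reasoning
  ... | g , 𝟙>0 = g , λ C∈ viol →
    All.lookup (𝟙>0⇒ (admissible? ⊤ g) 𝟙>0) C∈ (All.universal (λ _ → ∈⊤ , ∈⊤) _ , viol)

-- Subsets, their elements and their images

elements : {n : ℕ} → Subset n → List (Fin n)
elements []            = []
elements (inside  ∷ p) = zero ∷ map suc (elements p)
elements (outside ∷ p) = map suc (elements p)

length-elements : {n : ℕ} (p : Subset n) → length (elements p) ≡ ∣ p ∣
length-elements []            = refl
length-elements (inside  ∷ p) = cong suc (trans (length-map suc (elements p)) (length-elements p))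
length-elements (outside ∷ p) = trans (length-map suc (elements p)) (length-elements p)

elements-unique : {n : ℕ} (p : Subset n) → Unique (elements p)
elements-unique []            = []
elements-unique (inside  ∷ p) = All.map⁺ (All.universal (λ _ ()) _) ∷ map⁺ Fin.suc-injective (elements-unique p)
elements-unique (outside ∷ p) = map⁺ Fin.suc-injective (elements-unique p)

∈-elements⁺ : {n : ℕ} (p : Subset n) {x : Fin n} → x Subset.∈ p → x ∈ elements p
∈-elements⁺ (inside  ∷ p) Vec.here       = here refl
∈-elements⁺ (inside  ∷ p) (Vec.there x∈) = there (∈-map⁺ suc (∈-elements⁺ p x∈))
∈-elements⁺ (outside ∷ p) (Vec.there x∈) = ∈-map⁺ suc (∈-elements⁺ p x∈)

∈-elements⁻ : {n : ℕ} (p : Subset n) {x : Fin n} → x ∈ elements p → x Subset.∈ p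
∈-elements⁻ (inside  ∷ p) (here refl) = Vec.here
∈-elements⁻ (inside  ∷ p) (there x∈) with ∈-map⁻ suc x∈
... | y , y∈ , refl = Vec.there (∈-elements⁻ p y∈)
∈-elements⁻ (outside ∷ p) x∈ with ∈-map⁻ suc x∈
... | y , y∈ , refl = Vec.there (∈-elements⁻ p y∈)

setOf : {n : ℕ} → List (Fin n) → Subset n
setOf = foldr (λ x p → ⁅ x ⁆ ∪ p) ⊥

∈-setOf⁺ : {n : ℕ} {xs : List (Fin n)} {x : Fin n} → x ∈ xs → x Subset.∈ setOf xs
∈-setOf⁺ (here refl) = x∈p∪q⁺ (inj₁ (x∈⁅x⁆ _))
∈-setOf⁺ (there x∈)  = x∈p∪q⁺ (inj₂ (∈-setOf⁺ x∈))

∈-setOf⁻ : {n : ℕ} (xs : List (Fin n)) {x : Fin n} → x Subset.∈ setOf xs → x ∈ xs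
∈-setOf⁻ []       x∈ = contradiction x∈ ∉⊥
∈-setOf⁻ (y ∷ ys) x∈ with x∈p∪q⁻ ⁅ y ⁆ (setOf ys) x∈
... | inj₁ x∈y  = here (x∈⁅y⁆⇒x≡y y x∈y)
... | inj₂ x∈ys = there (∈-setOf⁻ ys x∈ys)

setOf-elements : {n : ℕ} (p : Subset n) → setOf (elements p) ≡ p
setOf-elements p = ⊆-antisym (∈-elements⁻ p ∘ ∈-setOf⁻ (elements p)) (∈-setOf⁺ ∘ ∈-elements⁺ p)

setOf-↭ : {n : ℕ} {xs ys : List (Fin n)} → xs ↭ ys → setOf xs ≡ setOf ys
setOf-↭ xs↭ys = ⊆-antisym (∈-setOf⁺ ∘ ∈-resp-↭ xs↭ys ∘ ∈-setOf⁻ _) (∈-setOf⁺ ∘ ∈-resp-↭ (↭-sym xs↭ys) ∘ ∈-setOf⁻ _)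

module _ {h n : ℕ} (φ : Fin h → Fin n) (s : Subset h) where

  private
    -- `hits` and `or` name the pieces of the fold in `image`, so that its Boolean computation can
    -- be traded for list membership.
    hits : Fin n → Fin h → Bool
    hits j i = lookup s i ∧ (toℕ (φ i) ≡ᵇ toℕ j)

    or : (Fin h → Bool) → List (Fin h) → Bool
    or f = foldr (λ i b → f i ∨ b) false

    or⁺ : ∀ f {xs i} → i ∈ xs → f i ≡ true → or f xs ≡ true
    or⁺ f {i ∷ xs} (here refl) fi rewrite fi = refl
    or⁺ f {i ∷ xs} (there i∈)  fi with f i
    ... | true  = refl
    ... | false = or⁺ f i∈ fi

    or⁻ : ∀ f xs → or f xs ≡ true → ∃ λ i → f i ≡ true
    or⁻ f (i ∷ xs) eq with f i in fi
    ... | true  = i , fi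
    ... | false = or⁻ f xs eq

  ∈-image⁺ : ∀ {i} → i Subset.∈ s → φ i Subset.∈ image φ s
  ∈-image⁺ {i} i∈s = lookup⇒[]= (φ i) _ (trans (lookup∘tabulate _ (φ i)) (or⁺ (hits (φ i)) (∈-allFin i) hit))
    where
    hit : hits (φ i) i ≡ true
    hit rewrite []=⇒lookup i∈s = Equivalence.to T-≡ (≡⇒≡ᵇ (toℕ (φ i)) _ refl)

  ∈-image⁻ : ∀ {j} → j Subset.∈ image φ s → ∃ λ i → i Subset.∈ s × φ i ≡ j
  ∈-image⁻ {j} j∈ with or⁻ (hits j) (allFin h) (trans (sym (lookup∘tabulate _ j)) ([]=⇒lookup j∈))
  ... | i , hit with lookup s i in i∈s
  ...   | true = i , lookup⇒[]= i s i∈s , Fin.toℕ-injective (≡ᵇ⇒≡ _ _ (Equivalence.from T-≡ hit))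

-- Serves to replace an embedding by its tabulated vector, with which it agrees only pointwise.
image-cong : {h n : ℕ} {φ ψ : Fin h → Fin n} → (∀ i → φ i ≡ ψ i) → ∀ s → image φ s ≡ image ψ s
image-cong {φ = φ} {ψ} φ≗ψ s = ⊆-antisym (⊆-half φ ψ φ≗ψ) (⊆-half ψ φ (sym ∘ φ≗ψ))
  where
  ⊆-half : ∀ φ ψ → (∀ i → φ i ≡ ψ i) → image φ s Subset.⊆ image ψ s
  ⊆-half φ ψ φ≗ψ j∈ with ∈-image⁻ φ s j∈
  ... | i , i∈ , refl = subst (Subset._∈ image ψ s) (sym (φ≗ψ i)) (∈-image⁺ ψ s i∈)

image-injective : {h n : ℕ} {φ : Fin h → Fin n} → Injective _≡_ _≡_ φ → Injective _≡_ _≡_ (image φ)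
image-injective {φ = φ} inj {s} {t} eq = ⊆-antisym (⊆-half eq) (⊆-half (sym eq))
  where
  ⊆-half : ∀ {s t} → image φ s ≡ image φ t → s Subset.⊆ t
  ⊆-half {s} {t} eq {i} i∈ with ∈-image⁻ φ t (subst (φ i Subset.∈_) eq (∈-image⁺ φ s i∈))
  ... | i′ , i′∈ , φi′≡φi = subst (Subset._∈ t) (inj φi′≡φi) i′∈

-- Both lists are duplicate-free, the first by injectivity of `φ`, and they have the same members.
map↭elements-image : {h n : ℕ} {φ : Fin h → Fin n} → Injective _≡_ _≡_ φ → {t : List (Fin h)} → Unique t →
  map φ t ↭ elements (image φ (setOf t))
map↭elements-image {φ = φ} inj {t} !t =
  ∼bag⇒↭ (unique∧set⇒bag (map⁺ inj !t) (elements-unique (image φ (setOf t))) (mk⇔ to from))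
  where
  to : ∀ {j} → j ∈ map φ t → j ∈ elements (image φ (setOf t))
  to j∈ with ∈-map⁻ φ j∈
  ... | i , i∈ , refl = ∈-elements⁺ _ (∈-image⁺ φ (setOf t) (∈-setOf⁺ i∈))
  from : ∀ {j} → j ∈ elements (image φ (setOf t)) → j ∈ map φ t
  from j∈ with ∈-image⁻ φ (setOf t) (∈-elements⁻ _ j∈)
  ... | i , i∈ , refl = ∈-map⁺ φ (∈-setOf⁻ t i∈)

-- Lengths of the enumerations

length-filter-∑ : {A : Set} {P : Pred A _} (P? : Decidable P) (xs : List A) →
  length (filter P? xs) ≡ ∑ xs (𝟙 ∘ P?)
length-filter-∑ P? []       = refl
length-filter-∑ P? (x ∷ xs) with P? x
... | yes _ = cong suc (length-filter-∑ P? xs)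
... | no  _ = length-filter-∑ P? xs

length-concatMap-≤ : {A B : Set} (f : A → List B) (xs : List A) {m : ℕ} → (∀ {x} → x ∈ xs → length (f x) ≤ m) →
  length (concatMap f xs) ≤ length xs * m
length-concatMap-≤ f []       f≤m = z≤n
length-concatMap-≤ f (x ∷ xs) f≤m rewrite length-++ (f x) {concatMap f xs} =
  +-mono-≤ (f≤m (here refl)) (length-concatMap-≤ f xs (f≤m ∘ there))

length-cartesianProduct : {A B : Set} (xs : List A) (ys : List B) →
  length (cartesianProduct xs ys) ≡ length xs * length ys
length-cartesianProduct []       ys = refl
length-cartesianProduct (x ∷ xs) ys = trans (length-++ (map (x ,_) ys))
  (cong₂ _+_ (length-map (x ,_) ys) (length-cartesianProduct xs ys))

∈-vecs⁻ : {A : Set} (xs : List A) {m : ℕ} {v : Vec A m} → v ∈ vecs xs m → ∀ i → lookup v i ∈ xs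
∈-vecs⁻ xs {suc m} v∈ i with ∈-cartesianProductWith⁻ _∷_ xs (vecs xs m) v∈
∈-vecs⁻ xs v∈ zero    | _ , _ , a∈ , v′∈ , refl = a∈
∈-vecs⁻ xs v∈ (suc i) | _ , _ , a∈ , v′∈ , refl = ∈-vecs⁻ xs v′∈ i

maps? : {n h : ℕ} (t : List (Fin h)) (cs : List (Fin n)) → Decidable (λ (φ : Vec (Fin n) h) → map (lookup φ) t ≡ cs)
maps? t cs φ = List-≡-dec Fin._≟_ (map (lookup φ) t) cs

-- The entries of `t` are distinct coordinates of `φ`, and prescribing each of them costs a factor
-- `n`, by the same double counting as for colours.
#-maps : {n h : ℕ} {t : List (Fin h)} → Unique t → (cs : List (Fin n)) → n ^ length t * # (maps? {n} {h} t cs) ≤ n ^ h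
#-maps {n} {h} [] cs = begin
  1 * # (maps? {n} {h} [] cs)           ≡⟨ *-identityˡ _ ⟩
  # (maps? {n} {h} [] cs)               ≤⟨ ∑-mono (allVecs n h) (λ {φ} _ → 𝟙-≤ (maps? {n} {h} [] cs φ) (λ _ → s≤s z≤n)) ⟩
  ∑ (allVecs n h) (λ _ → 1)     ≡⟨ ∑-const (allVecs n h) 1 ⟩
  length (allVecs n h) * 1      ≡⟨ *-identityʳ _ ⟩
  length (allVecs n h)          ≡⟨ length-allVecs n h ⟩
  n ^ h                         ∎
  where open ≤-Reasoning
#-maps {n} {h} {x ∷ t} (x∉t ∷ !t) cs = begin
  n * n ^ length t * # Q?       ≡⟨ cong (_* # Q?) (*-comm n (n ^ length t)) ⟩
  n ^ length t * n * # Q?       ≡⟨ *-assoc (n ^ length t) n (# Q?) ⟩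
  n ^ length t * (n * # Q?)     ≤⟨ *-monoʳ-≤ (n ^ length t) (#-determined (maps? t (tail cs)) Q? x (value cs) (solve cs)) ⟩
  n ^ length t * # (maps? t (tail cs)) ≤⟨ #-maps !t (tail cs) ⟩
  n ^ h                         ∎
  where
  open ≤-Reasoning
  Q? = maps? (x ∷ t) cs
  -- No `φ` sends the nonempty `x ∷ t` to an empty `cs`, so the values of `tail` and `value` there
  -- are mere defaults.
  tail : List (Fin n) → List (Fin n)
  tail = List.drop 1
  value : List (Fin n) → Vec (Fin n) h → Fin n
  value []      φ = lookup φ x
  value (c ∷ _) _ = c
  solve : ∀ cs φ c → map (lookup (φ [ x ]≔ c)) (x ∷ t) ≡ cs → map (lookup φ) t ≡ tail cs × c ≡ value cs φ
  solve (_ ∷ _) φ c refl =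
    map-cong-local (All.map (λ x≢i → sym (lookup∘update′ (x≢i ∘ sym) φ c)) x∉t) , sym (lookup∘update x φ c)

#-maps-≤ : {n h r : ℕ} .{{_ : NonZero n}} {t : List (Fin h)} → Unique t → length t ≡ r → r ≤ h → (cs : List (Fin n)) →
  # (maps? {n} {h} t cs) ≤ n ^ (h ∸ r)
#-maps-≤ {n} {h} {r} {t} !t refl r≤h cs = *-cancelˡ-≤ (n ^ r) {{m^n≢0 n r}} (begin
  n ^ r * # (maps? {n} {h} t cs)  ≤⟨ #-maps !t cs ⟩
  n ^ h                   ≡⟨ cong (n ^_) (sym (m+[n∸m]≡n r≤h)) ⟩
  n ^ (r + (h ∸ r))       ≡⟨ ^-distribˡ-+-* n r (h ∸ r) ⟩
  n ^ r * n ^ (h ∸ r)     ∎)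
  where open ≤-Reasoning

unique? : {n : ℕ} → Decidable (Unique {A = Fin n})
unique? = DecUnique.unique? Fin._≟_

-- The entries keep an order so that a tuple can be matched entry by entry with the listing of an
-- edge. The crude bound `h ^ r` on their number suffices.
tuples : (h r : ℕ) → List (List (Fin h))
tuples h r = filter unique? (map toList (allVecs h r))

∈-tuples⁺ : {h r : ℕ} {t : List (Fin h)} → Unique t → length t ≡ r → t ∈ tuples h r
∈-tuples⁺ {h} {r} {t} !t refl =
  ∈-filter⁺ unique? (subst (_∈ map toList (allVecs h r)) (toList∘fromList t)
    (∈-map⁺ toList (∈-vecs (fromList t) (λ _ → ∈-allFin _)))) !t

∈-tuples⁻ : {h r : ℕ} {t : List (Fin h)} → t ∈ tuples h r → Unique t × length t ≡ r
∈-tuples⁻ {h} {r} t∈ with ∈-filter⁻ unique? {xs = map toList (allVecs h r)} t∈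
... | t∈′ , !t with ∈-map⁻ toList t∈′
...   | v , _ , refl = !t , length-toList v

length-tuples : ∀ h r → length (tuples h r) ≤ h ^ r
length-tuples h r = ≤-trans (length-filter unique? (map toList (allVecs h r)))
  (≤-reflexive (trans (length-map toList (allVecs h r)) (length-allVecs h r)))

triangular-map : {N : ℕ} {A : Set} (f : A → Fin N × Fin N) → (∀ a → proj₁ (f a) ≢ proj₂ (f a)) →
  (∀ {a b} → a ≢ b → ¬ Occurs (proj₁ (f a)) (f b)) → {as : List A} → Unique as → Triangular (map f as)
triangular-map f x≢y x∉ []         = _
triangular-map f x≢y x∉ (a∉ ∷ !as) =
  x≢y _ , All.map⁺ (All.map x∉ a∉) , triangular-map f x≢y x∉ !as

-- The constraints of a hypergraph colouring

module Events {n h r q : ℕ} .{{_ : NonZero n}} (0<h : 0 < h) (r≤h : r ≤ h) (0<q : 0 < q)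
  (large : 2 * (h * ((h ^ r * h ^ r) ^ h * n ^ (h ∸ r))) ≤ q ^ h) where

  -- Subsets of every size are included, since an `EdgeColoring` is total on subsets.
  variables : List (Fin n × Subset n)
  variables = cartesianProduct (allFin n) (vecs (inside ∷ outside ∷ []) n)

  ∈-variables : ∀ z → z ∈ variables
  ∈-variables (v , e) = ∈-cartesianProduct⁺ (∈-allFin v) (∈-vecs e (side ∘ lookup e))
    where
    side : ∀ b → b ∈ inside ∷ outside ∷ []
    side true  = here refl
    side false = there (here refl)

  N = length variables

  encode : Fin n × Subset n → Fin N
  encode z = Any.index (∈-variables z)

  decode : Fin N → Fin n × Subset n
  decode = List.lookup variables

  decode-encode : ∀ z → decode (encode z) ≡ z
  decode-encode z = sym (lookup-index (∈-variables z))

  encode-injective : Injective _≡_ _≡_ encode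
  encode-injective {y} {z} eq = trans (sym (decode-encode y)) (trans (cong decode eq) (decode-encode z))

  -- r-subsets of Fin h are given by tuples listing them, with repetition over the orders.
  Tuple = List (Fin h)

  Pairs = Vec (Tuple × Tuple) h

  allPairs : List Pairs
  allPairs = vecs (cartesianProduct (tuples h r) (tuples h r)) h

  length-allPairs : length allPairs ≤ (h ^ r * h ^ r) ^ h
  length-allPairs = begin
    length allPairs ≡⟨ length-vecs _ h ⟩
    length (cartesianProduct (tuples h r) (tuples h r)) ^ h ≡⟨ cong (_^ h) (length-cartesianProduct (tuples h r) _) ⟩
    (length (tuples h r) * length (tuples h r)) ^ h ≤⟨ ^-monoˡ-≤ h (*-mono-≤ (length-tuples h r) (length-tuples h r)) ⟩
    (h ^ r * h ^ r) ^ h ∎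
    where open ≤-Reasoning

  -- The colour that the vertex φ j assigns to the edge φ(t).
  var : Vec (Fin n) h → Fin h → Tuple → Fin N
  var φ j t = encode (lookup φ j , image (lookup φ) (setOf t))

  equation : Vec (Fin n) h → Pairs → Fin h → Fin N × Fin N
  equation φ w j = var φ j (proj₁ (lookup w j)) , var φ j (proj₂ (lookup w j))

  constraint : Vec (Fin n) h × Pairs → Constraint N
  constraint (φ , w) = map (equation φ w) (allFin h)

  -- Distinctness is asked of the underlying sets, because two orders of one set give the same
  -- variable.
  Good : Vec (Fin n) h × Pairs → Set
  Good (φ , w) = (∀ i j → lookup φ i ≡ lookup φ j → i ≡ j) ×
                 (∀ j → setOf (proj₁ (lookup w j)) ≢ setOf (proj₂ (lookup w j)))

  good? : Decidable Good
  good? (φ , w) = Fin.all? (λ i → Fin.all? (λ j → lookup φ i Fin.≟ lookup φ j →-dec i Fin.≟ j)) ×-dec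
                  Fin.all? (λ j → ¬? (Vec.≡-dec Bool._≟_ (setOf (proj₁ (lookup w j))) (setOf (proj₂ (lookup w j)))))

  -- The equations for different `j` belong to different vertices `φ j` and so share no variable.
  -- Within one equation the two edges have different images, as `φ` is injective.
  good⇒triangular : ∀ φw → Good φw → Triangular (constraint φw)
  good⇒triangular (φ , w) (inj , distinct) = triangular-map (equation φ w)
    (λ j eq → distinct j (image-injective (λ {i} {j} → inj i j) (,-injectiveʳ (encode-injective eq))))
    (λ j≢j′ → [ j≢j′ ∘ same-vertex , j≢j′ ∘ same-vertex ]′)
    (allFin⁺ h)
    where
    same-vertex : ∀ {i j d e} → encode (lookup φ i , d) ≡ encode (lookup φ j , e) → i ≡ j
    same-vertex {i} {j} eq = inj i j (,-injectiveˡ (encode-injective eq))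

  module _ {k : ℕ} (g : Vec (Fin k) N) where

    Monochromatic : Vec (Fin n) h → Fin h → Tuple × Tuple → Set
    Monochromatic φ j (t , u) = lookup g (var φ j t) ≡ lookup g (var φ j u)

    violates⁺ : ∀ φ w → (∀ j → Monochromatic φ j (lookup w j)) → Violates (constraint (φ , w)) g
    violates⁺ φ w mono = All.map⁺ (All.universal mono (allFin h))

    violates⁻ : ∀ φ w → Violates (constraint (φ , w)) g → ∀ j → Monochromatic φ j (lookup w j)
    violates⁻ φ w viol j = All.lookup (All.map⁻ viol) (∈-allFin j)

  -- The constraints through a given variable

  𝒞 : List (Constraint N)
  𝒞 = map constraint (filter good? (cartesianProduct (allVecs n h) allPairs))

  extensions : Subset n → Fin h → Pairs → List (Vec (Fin n) h × Pairs)
  extensions e i w = map (_, w) (filter (maps? (proj₁ (lookup w i)) (elements e)) (allVecs n h))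

  -- Here `i` is the index of the equation through the variable, and `φ` has to send the first tuple
  -- of pair `i` to the increasing listing of `e`. This fixes `φ` at `r` vertices; hence the factors
  -- `h`, `(h ^ r * h ^ r) ^ h` and `n ^ (h ∸ r)` in the bound.
  candidates : Subset n → List (Vec (Fin n) h × Pairs)
  candidates e = concatMap (λ i → concatMap (extensions e i) allPairs) (allFin h)

  at : Fin N → List (Constraint N)
  at x = map constraint (filter good? (candidates (proj₂ (decode x))))

  length-candidates : ∀ e → length (candidates e) ≤ h * ((h ^ r * h ^ r) ^ h * n ^ (h ∸ r))
  length-candidates e = begin
    length (candidates e)
      ≤⟨ length-concatMap-≤ _ (allFin h) (λ {i} _ → length-concatMap-≤ (extensions e i) allPairs (length-extensions i)) ⟩
    length (allFin h) * (length allPairs * n ^ (h ∸ r))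
      ≤⟨ *-mono-≤ (≤-reflexive (length-allFin h)) (*-monoˡ-≤ (n ^ (h ∸ r)) length-allPairs) ⟩
    h * ((h ^ r * h ^ r) ^ h * n ^ (h ∸ r)) ∎
    where
    open ≤-Reasoning
    length-extensions : ∀ i {w} → w ∈ allPairs → length (extensions e i w) ≤ n ^ (h ∸ r)
    length-extensions i {w} w∈ with
      ∈-tuples⁻ {r = r} (proj₁ (∈-cartesianProduct⁻ (tuples h r) (tuples h r) (∈-vecs⁻ _ w∈ i)))
    ... | !t , ∣t∣≡r = begin
      length (extensions e i w)                     ≡⟨ length-map (_, w) (filter (maps? t (elements e)) (allVecs n h)) ⟩
      length (filter (maps? t (elements e)) (allVecs n h)) ≡⟨ length-filter-∑ (maps? t (elements e)) (allVecs n h) ⟩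
      # (maps? {n} {h} t (elements e))              ≤⟨ #-maps-≤ !t ∣t∣≡r r≤h (elements e) ⟩
      n ^ (h ∸ r)                                   ∎
      where t = proj₁ (lookup w i)

  few : ∀ x → 2 * length (at x) ≤ q ^ h
  few x = begin
    2 * length (at x)
      ≡⟨ cong (2 *_) (length-map constraint (filter good? (candidates e))) ⟩
    2 * length (filter good? (candidates e))
      ≤⟨ *-monoʳ-≤ 2 (≤-trans (length-filter good? (candidates e)) (length-candidates e)) ⟩
    2 * (h * ((h ^ r * h ^ r) ^ h * n ^ (h ∸ r)))
      ≤⟨ large ⟩
    q ^ h ∎
    where
    open ≤-Reasoning
    e = proj₂ (decode x)

  shape : ∀ {x C} → C ∈ at x → Triangular C × length C ≡ h
  shape {x} C∈ with ∈-map⁻ constraint C∈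
  ... | φw , φw∈ , refl = good⇒triangular φw (proj₂ (∈-filter⁻ good? {xs = candidates (proj₂ (decode x))} φw∈)) ,
                          trans (length-map _ (allFin h)) (length-allFin h)

  nonempty : ∀ {C} → C ∈ 𝒞 → C ≢ []
  nonempty C∈ with ∈-map⁻ constraint C∈
  ... | (φ , w) , _ , refl = λ eq → <⇒≢ 0<h
    (trans (sym (cong length eq)) (trans (length-map (equation φ w) (allFin h)) (length-allFin h)))

  -- The tuple t is reordered so that φ maps it to the increasing listing of φ(t).  Then t
  -- determines φ on its entries, which keeps the number of candidates free of a factor r!.
  dominated-by : ∀ φ w i t u → Good (φ , w) → w ∈ allPairs → t ∈ tuples h r → u ∈ tuples h r →
    setOf t ≢ setOf u → (∀ {k} (g : Vec (Fin k) N) → Monochromatic g φ i (lookup w i) → Monochromatic g φ i (t , u)) →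
    ∃ λ C′ → C′ ∈ at (var φ i t) × (∀ {k} (g : Vec (Fin k) N) → Violates (constraint (φ , w)) g → Violates C′ g)
  dominated-by φ w i t u (inj , distinct) w∈ t∈ u∈ t≢u mono⇒
    with ∈-tuples⁻ {r = r} t∈
  ... | !t , ∣t∣≡r with ↭-map-inv (lookup φ) (map↭elements-image (λ {i} {j} → inj i j) {t} !t)
  ...   | t′ , es≡ , t↭t′ =
    constraint (φ , w′) , ∈-map⁺ constraint (∈-filter⁺ good? member (inj , distinct′)) , viol
    where
    e = image (lookup φ) (setOf t)
    w′ = w [ i ]≔ (t′ , u)
    t′∈ : t′ ∈ tuples h r
    t′∈ = ∈-tuples⁺ (map⁻ (subst Unique es≡ (elements-unique e))) (trans (sym (↭-length t↭t′)) ∣t∣≡r)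
    t≈t′ : setOf t ≡ setOf t′
    t≈t′ = setOf-↭ t↭t′
    -- As `w′` differs from `w` only at `i`, a property of all pairs has to be rechecked for the new
    -- pair alone.
    w′-cases : (P : Fin h → Tuple × Tuple → Set) → (∀ j → P j (lookup w j)) → P i (t′ , u) → ∀ j → P j (lookup w′ j)
    w′-cases P Pw Pi j with i Fin.≟ j
    ... | yes refl = subst (P i) (sym (lookup∘update i w _)) Pi
    ... | no  i≢j  = subst (P j) (sym (lookup∘update′ (i≢j ∘ sym) w _)) (Pw j)
    w′∈ : w′ ∈ allPairs
    w′∈ = ∈-vecs w′ (w′-cases (λ _ p → p ∈ cartesianProduct (tuples h r) (tuples h r))
      (∈-vecs⁻ _ w∈) (∈-cartesianProduct⁺ t′∈ u∈))
    distinct′ : ∀ j → setOf (proj₁ (lookup w′ j)) ≢ setOf (proj₂ (lookup w′ j))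
    distinct′ = w′-cases (λ _ p → setOf (proj₁ p) ≢ setOf (proj₂ p)) distinct (t≢u ∘ trans t≈t′)
    maps : map (lookup φ) (proj₁ (lookup w′ i)) ≡ elements e
    maps = trans (cong (map (lookup φ) ∘ proj₁) (lookup∘update i w (t′ , u))) (sym es≡)
    member : (φ , w′) ∈ candidates (proj₂ (decode (var φ i t)))
    member = subst (λ z → (φ , w′) ∈ candidates (proj₂ z)) (sym (decode-encode _))
      (∈-concatMap⁺ _ (lose (∈-allFin i) (∈-concatMap⁺ _ (lose w′∈
        (∈-map⁺ (_, w′) (∈-filter⁺ (maps? (proj₁ (lookup w′ i)) (elements e)) (∈-vecs φ (λ _ → ∈-allFin _)) maps))))))
    viol : ∀ {k} (g : Vec (Fin k) N) → Violates (constraint (φ , w)) g → Violates (constraint (φ , w′)) g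
    viol g violated = violates⁺ g φ w′ (w′-cases (Monochromatic g φ) mono
      (trans (cong (λ s → lookup g (encode (lookup φ i , image (lookup φ) s))) (sym t≈t′)) (mono⇒ g (mono i))))
      where mono = violates⁻ g φ w violated

  -- If the variable is a right-hand side, pair `i` is swapped, because `at` finds constraints by
  -- the first tuple of a pair. Equality of colours is symmetric, so the violation persists.
  dominated : ∀ {x xy C} → C ∈ 𝒞 → xy ∈ C → Occurs x xy →
    ∃ λ C′ → C′ ∈ at x × (∀ (g : Vec (Fin (2 * q)) N) → Violates C g → Violates C′ g)
  dominated {x} C∈ xy∈ occ with ∈-map⁻ constraint C∈
  ... | (φ , w) , φw∈ , refl
    with ∈-filter⁻ good? {xs = cartesianProduct (allVecs n h) allPairs} φw∈ | ∈-map⁻ (equation φ w) xy∈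
  ...   | φw∈′ , good | i , _ , refl with ∈-cartesianProduct⁻ (allVecs n h) allPairs φw∈′
  ...     | _ , w∈ with ∈-cartesianProduct⁻ (tuples h r) (tuples h r) (∈-vecs⁻ _ w∈ i)
  ...       | t∈ , u∈ with occ
  ...         | inj₁ refl = let C′ , C′∈ , viol = dominated-by φ w i _ _ good w∈ t∈ u∈ (proj₂ good i) (λ _ → id)
                            in C′ , C′∈ , λ g → viol g
  ...         | inj₂ refl = let C′ , C′∈ , viol = dominated-by φ w i _ _ good w∈ u∈ t∈ (proj₂ good i ∘ sym) (λ _ → sym)
                            in C′ , C′∈ , λ g → viol g

  -- From an avoiding assignment to a local colouring

  colouring : Vec (Fin (2 * q)) N → Fin n → EdgeColoring n (2 * q)
  colouring g v e = lookup g (encode (v , e))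

  module _ (H : Hypergraph r h) (g : Vec (Fin (2 * q)) N) (avoids : ∀ {C} → C ∈ 𝒞 → ¬ Violates C g) where

    private
      f = colouring g

    module _ (φ : Fin h → Fin n) (inj : Injective _≡_ _≡_ φ) where
      Clash : Fin h → Subset h → Subset h → Set
      Clash i e e′ = e ≢ e′ × f (φ i) (image φ e) ≡ f (φ i) (image φ e′)
      HasClash : Fin h → Set
      HasClash i = Any (λ e → Any (Clash i e) (edges H)) (edges H)
      hasClash? : Decidable HasClash
      hasClash? i = any? (λ e → any? (λ e′ → ¬? (Vec.≡-dec Bool._≟_ e e′) ×-dec
        f (φ i) (image φ e) Fin.≟ f (φ i) (image φ e′)) (edges H)) (edges H)
      -- A clash chosen at every vertex gives pairs of edges which, listed as tuples, define a
      -- member of `𝒞` that `g` violates.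
      ¬all-clash : ¬ (∀ i → HasClash i)
      ¬all-clash clash = avoids (∈-map⁺ constraint (∈-filter⁺ good?
        (∈-cartesianProduct⁺ (∈-vecs φ′ (λ _ → ∈-allFin _)) w∈) (inj′ , distinct)))
        (violates⁺ g φ′ w mono)
        where
        choice : ∀ i → ∃ λ e → ∃ λ e′ → e ∈ edges H × e′ ∈ edges H × Clash i e e′
        choice i with find (clash i)
        ... | e , e∈ , clash′ with find clash′
        ...   | e′ , e′∈ , c = e , e′ , e∈ , e′∈ , c
        φ′ = tabulate φ
        pair : Fin h → Tuple × Tuple
        pair i = elements (proj₁ (choice i)) , elements (proj₁ (proj₂ (choice i)))
        w = tabulate pair
        edge-tuple : ∀ {e} → e ∈ edges H → elements e ∈ tuples h r
        edge-tuple {e} e∈ = ∈-tuples⁺ (elements-unique e) (trans (length-elements e) (All.lookup (uniform H) e∈))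
        w-all : (P : Fin h → Tuple × Tuple → Set) → (∀ j → P j (pair j)) → ∀ j → P j (lookup w j)
        w-all P Pp j = subst (P j) (sym (lookup∘tabulate pair j)) (Pp j)
        w∈ : w ∈ allPairs
        w∈ = ∈-vecs w (w-all (λ _ p → p ∈ cartesianProduct (tuples h r) (tuples h r)) λ j →
          let _ , _ , e∈ , e′∈ , _ = choice j in ∈-cartesianProduct⁺ (edge-tuple e∈) (edge-tuple e′∈))
        inj′ : ∀ i j → lookup φ′ i ≡ lookup φ′ j → i ≡ j
        inj′ i j eq = inj (trans (sym (lookup∘tabulate φ i)) (trans eq (lookup∘tabulate φ j)))
        distinct : ∀ j → setOf (proj₁ (lookup w j)) ≢ setOf (proj₂ (lookup w j))
        distinct = w-all (λ _ p → setOf (proj₁ p) ≢ setOf (proj₂ p)) λ j eq →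
          let e , e′ , _ , _ , e≢e′ , _ = choice j in e≢e′ (trans (sym (setOf-elements e)) (trans eq (setOf-elements e′)))
        colour : ∀ j e → lookup g (var φ′ j (elements e)) ≡ f (φ j) (image φ e)
        colour j e = cong (lookup g ∘ encode) (cong₂ _,_ (lookup∘tabulate φ j)
          (trans (image-cong (lookup∘tabulate φ) (setOf (elements e))) (cong (image φ) (setOf-elements e))))
        mono : ∀ j → Monochromatic g φ′ j (lookup w j)
        mono = w-all (Monochromatic g φ′) λ j →
          let e , e′ , _ , _ , _ , same = choice j in trans (colour j e) (trans same (sym (colour j e′)))
      rainbow : Σ (Fin h) λ i → Rainbow H φ (f (φ i))
      -- Clashes are decidable, so the refuted universal statement yields a vertex without one.
      rainbow = let i , ¬clash = Fin.¬∀⟶∃¬ h HasClash hasClash? ¬all-clash in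
        i , λ e e′ e∈ e′∈ e≢e′ same → ¬clash (lose e∈ (lose e′∈ (e≢e′ , same)))

  localColouring : (H : Hypergraph r h) → LocalColoring n H (2 * q)
  localColouring H = colouring (proj₁ coloured) , rainbow H (proj₁ coloured) (proj₂ coloured)
    where
    coloured : ∃ λ (g : Vec (Fin (2 * q)) N) → ∀ {C} → C ∈ 𝒞 → ¬ Violates C g
    coloured = Avoidance.avoiding 𝒞 at 0<q nonempty (λ {x} → shape {x}) few dominated

-- The number of colours

-- Induction on `d`: the old `q` is kept while its power is large enough. Otherwise `q ^ h` equals
-- the previous `d` exactly, and doubling `q` multiplies it by `2 ^ h`, which is at least 2.
approx-root : ∀ h d → 0 < h → 0 < d → ∃ λ q → d ≤ q ^ h × q ^ h ≤ 2 ^ h * d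
approx-root h (suc zero) 0<h _ = 1 , ≤-reflexive (sym (^-zeroˡ h)) , (begin
  1 ^ h     ≡⟨ ^-zeroˡ h ⟩
  1         ≤⟨ m^n>0 2 h ⟩
  2 ^ h     ≡⟨ sym (*-identityʳ (2 ^ h)) ⟩
  2 ^ h * 1 ∎)
  where open ≤-Reasoning
approx-root h (suc d@(suc _)) 0<h _ with approx-root h d 0<h (s≤s z≤n)
... | q , d≤ , ≤d with suc d ≤? q ^ h
...   | yes d< = q , d< , ≤-trans ≤d (*-monoʳ-≤ (2 ^ h) (n≤1+n d))
...   | no  d≮ = 2 * q , lower , ≤-trans (≤-reflexive [2q]^h) (*-monoʳ-≤ (2 ^ h) (n≤1+n d))
  where
  open ≤-Reasoning
  [2q]^h : (2 * q) ^ h ≡ 2 ^ h * d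
  [2q]^h = trans (^-distribʳ-* h 2 q) (cong (2 ^ h *_) (≤-antisym (≮⇒≥ d≮) d≤))
  lower : suc d ≤ (2 * q) ^ h
  lower = begin
    1 + d         ≤⟨ +-monoˡ-≤ d (s≤s z≤n) ⟩
    d + d         ≡⟨ cong (d +_) (sym (+-identityʳ d)) ⟩
    2 ^ 1 * d     ≤⟨ *-monoˡ-≤ d (^-monoʳ-≤ 2 0<h) ⟩
    2 ^ h * d     ≡⟨ sym [2q]^h ⟩
    (2 * q) ^ h   ∎

-- The leading `h`, which counts the index of the equation, is enlarged to `h ^ r`; this is the `r`
-- added to `2 * r * h` in the exponent.
candidates-bound : ∀ h r m → 0 < h → 0 < r → h * ((h ^ r * h ^ r) ^ h * m) ≤ m * h ^ (2 * r * h + r)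
candidates-bound h r m 0<h 0<r = begin
  h * ((h ^ r * h ^ r) ^ h * m)
    ≤⟨ *-monoˡ-≤ _ (≤-trans (≤-reflexive (sym (^-identityʳ h))) (^-monoʳ-≤ h {{>-nonZero 0<h}} 0<r)) ⟩
  h ^ r * ((h ^ r * h ^ r) ^ h * m)
    ≡⟨ cong (λ y → h ^ r * (y * m)) power ⟩
  h ^ r * (h ^ (2 * r * h) * m)
    ≡⟨ rotate (h ^ r) (h ^ (2 * r * h)) m ⟩
  m * (h ^ (2 * r * h) * h ^ r)
    ≡⟨ cong (m *_) (sym (^-distribˡ-+-* h (2 * r * h) r)) ⟩
  m * h ^ (2 * r * h + r) ∎
  where
  open ≤-Reasoning
  rotate : ∀ a b c → a * (b * c) ≡ c * (b * a)
  rotate = solve-∀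
  power : (h ^ r * h ^ r) ^ h ≡ h ^ (2 * r * h)
  power = trans (cong (_^ h) (trans (sym (^-distribˡ-+-* h r r)) (cong (λ s → h ^ (r + s)) (sym (+-identityʳ r)))))
                (^-*-assoc h (2 * r) h)

-- The factor `8 ^ h` collects `2 ^ h` from `k = 2 * q`, `2 ^ h` from rounding the root, and `2 ^ h`
-- as a bound for the 2 in `2 * D`.
localColouring-≤ : {n h r : ℕ} .{{_ : NonZero n}} → 0 < h → 0 < r → r ≤ h → (H : Hypergraph r h) →
  Σ ℕ λ k → LocalColoring n H k × (k ^ h ≤ 8 ^ h * n ^ (h ∸ r) * h ^ (2 * r * h + r))
localColouring-≤ {n} {h} {r} 0<h 0<r r≤h H =
  2 * q , Events.localColouring 0<h r≤h 0<q large H , (begin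
  (2 * q) ^ h                       ≡⟨ ^-distribʳ-* h 2 q ⟩
  2 ^ h * q ^ h                     ≤⟨ *-monoʳ-≤ (2 ^ h) q^h≤ ⟩
  2 ^ h * (2 ^ h * (2 ^ 1 * D))     ≤⟨ *-monoʳ-≤ (2 ^ h) (*-monoʳ-≤ (2 ^ h) (*-monoˡ-≤ D (^-monoʳ-≤ 2 0<h))) ⟩
  2 ^ h * (2 ^ h * (2 ^ h * D))     ≡⟨ reassoc (2 ^ h) (n ^ (h ∸ r)) (h ^ (2 * r * h + r)) ⟩
  2 ^ h * (2 ^ h * 2 ^ h) * n ^ (h ∸ r) * h ^ (2 * r * h + r)
    ≡⟨ cong (λ y → y * n ^ (h ∸ r) * h ^ (2 * r * h + r)) (sym 8^h) ⟩
  8 ^ h * n ^ (h ∸ r) * h ^ (2 * r * h + r) ∎)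
  where
  open ≤-Reasoning
  D = n ^ (h ∸ r) * h ^ (2 * r * h + r)
  2D>0 : 0 < 2 * D
  2D>0 = *-mono-< {0} {2} {0} (s≤s z≤n)
    (*-mono-< {0} {n ^ (h ∸ r)} {0} (m^n>0 n (h ∸ r)) (m^n>0 h {{>-nonZero 0<h}} (2 * r * h + r)))
  root = approx-root h (2 * D) 0<h 2D>0
  q = proj₁ root
  2D≤q^h : 2 * D ≤ q ^ h
  2D≤q^h = proj₁ (proj₂ root)
  q^h≤ : q ^ h ≤ 2 ^ h * (2 * D)
  q^h≤ = proj₂ (proj₂ root)
  0^ : ∀ {m} → 0 < m → 0 ^ m ≡ 0
  0^ (s≤s _) = refl
  0<q : 0 < q
  0<q = n≢0⇒n>0 λ q≡0 → <⇒≱ 2D>0 (≤-trans (subst (λ y → 2 * D ≤ y ^ h) q≡0 2D≤q^h) (≤-reflexive (0^ 0<h)))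
  large : 2 * (h * ((h ^ r * h ^ r) ^ h * n ^ (h ∸ r))) ≤ q ^ h
  large = ≤-trans (*-monoʳ-≤ 2 (candidates-bound h r (n ^ (h ∸ r)) 0<h 0<r)) 2D≤q^h
  8^h : 8 ^ h ≡ 2 ^ h * (2 ^ h * 2 ^ h)
  8^h = trans (^-distribʳ-* h 2 4) (cong (2 ^ h *_) (^-distribʳ-* h 2 2))
  reassoc : ∀ a b c → a * (a * (a * (b * c))) ≡ a * (a * a) * b * c
  reassoc = solve-∀

-- The bound is stated for `k ^ h`, which clears the fractional exponents `(h - r) / h` and `r / h`.
-- Since the minimum number of colours is at most `k`, it inherits the bound.
theorem1p10 : Σ ℕ λ c →
    (r h : ℕ) (H : Hypergraph r h) (n : ℕ) → 2 ≤ r → r ≤ h →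
    Σ ℕ λ k → LocalColoring n H k ×
    (k ^ h ≤ c ^ h * n ^ (h ∸ r) * h ^ (2 * r * h + r))
theorem1p10 = 8 , colours
  where
  colours : (r h : ℕ) (H : Hypergraph r h) (n : ℕ) → 2 ≤ r → r ≤ h →
    Σ ℕ λ k → LocalColoring n H k × (k ^ h ≤ 8 ^ h * n ^ (h ∸ r) * h ^ (2 * r * h + r))
  -- Without vertices no copy exists, so zero colours suffice.
  colours (suc _) (suc _) H zero _ _ = 0 , ((λ ()) , λ φ _ → contradiction (φ zero) λ ()) , z≤n
  colours (suc _) (suc _) H (suc _) _ r≤h = localColouring-≤ (s≤s z≤n) (s≤s z≤n) r≤h H
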